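{- Let $\mathcal S=(\mathcal P,\mathcal L)$ be a linear space with $v$ points, constant line size $k$ with $2<k<v$, and $r$ lines through each point; let $G\le\mathrm{Aut}(\mathcal S)$ be transitive on lines, and let $\mathfrak C$ be a non-trivial $G$-invariant partition of $\mathcal P$. If $\gcd(k,r)\le 8$, then $G$ is $2$-step imprimitive relative to $\mathfrak C$, that is, $\mathfrak C$ is both a minimal and a maximal non-trivial $G$-invariant partition of $\mathcal P$.
   Context: A linear space: a finite set $\mathcal P$ of points and a set $\mathcal L$ of subsets (lines) such that any two distinct points lie on exactly one line and each line has at least two points. A partition is non-trivial if it has more than one class and its classes have more than one element. $\mathfrak C$ is minimal if no non-trivial $G$-invariant partition strictly refines it, and maximal if no non-trivial $G$-invariant partition is strictly coarser than it. -}

module Defs where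

open import Data.Fin.Base using (Fin)
open import Data.Fin.Permutation as Perm using (Permutation′; _⟨$⟩ˡ_; _∘ₚ_)
open import Data.Fin.Subset using (Subset; _∈_; _⊆_; ∣_∣; Nonempty)
open import Data.Fin.Subset.Properties using (_∈?_)
open import Data.List.Base using (List; length; filter)
open import Data.List.Membership.Propositional using () renaming (_∈_ to _∈ₗ_)
open import Data.List.Relation.Binary.BagAndSetEquality using (_∼[_]_; set)
open import Data.List.Relation.Unary.Unique.Propositional using (Unique)
open import Data.Nat.Base using (ℕ; _<_; _≤_)
open import Data.Product using (∃; ∃!; ∃-syntax; _×_)
open import Data.Vec.Base using (tabulate; lookup)
open import Function.Bundles using (_⇔_)
open import Level using (Level)
open import Relation.Binary.PropositionalEquality using (_≡_; _≢_)
open import Relation.Nullary using (¬_)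
open import Relation.Unary using (Pred)

private
  variable
    ℓ : Level
    v : ℕ

-- A finite set of subsets of Fin v, listed without repetition (so that the
-- length of the list is the cardinality).  The order of the list is irrelevant
-- and is never used below.
record Family (v : ℕ) : Set where
  field
    members : List (Subset v)
    unique  : Unique members

open Family public

infix 4 _∈ᶠ_

_∈ᶠ_ : Subset v → Family v → Set
B ∈ᶠ 𝓕 = B ∈ₗ members 𝓕

record LinearSpace (v : ℕ) : Set where
  field
    lines      : Family v
    join       : ∀ {p q : Fin v} → p ≢ q →
                 ∃! _≡_ λ L → L ∈ᶠ lines × p ∈ L × q ∈ L
    two-points : ∀ {L} → L ∈ᶠ lines → 2 ≤ ∣ L ∣

open LinearSpace public

ConstantLineSize : LinearSpace v → ℕ → Set
ConstantLineSize 𝒮 k = ∀ {L} → L ∈ᶠ lines 𝒮 → ∣ L ∣ ≡ k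

linesThrough : LinearSpace v → Fin v → List (Subset v)
linesThrough 𝒮 p = filter (p ∈?_) (members (lines 𝒮))

-- The image { g x ∣ x ∈ B }: a point q belongs to it iff g⁻¹ q belongs to B.
image : Permutation′ v → Subset v → Subset v
image g B = tabulate λ q → lookup B (g ⟨$⟩ˡ q)

Aut : LinearSpace v → Pred (Permutation′ v) _
Aut 𝒮 g = ∀ B → B ∈ᶠ lines 𝒮 ⇔ image g B ∈ᶠ lines 𝒮

-- Permutations are compared extensionally, hence the field resp.
record IsSubgroup {v : ℕ} (G : Pred (Permutation′ v) ℓ) : Set ℓ where
  field
    resp    : ∀ {g h} → g Perm.≈ h → G g → G h
    id      : G Perm.id
    compose : ∀ {g h} → G g → G h → G (g ∘ₚ h)
    inverse : ∀ {g} → G g → G (Perm.flip g)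

LineTransitive : LinearSpace v → Pred (Permutation′ v) ℓ → Set ℓ
LineTransitive 𝒮 G = ∀ {L M} → L ∈ᶠ lines 𝒮 → M ∈ᶠ lines 𝒮 →
                     ∃[ g ] G g × image g L ≡ M

record Partition (v : ℕ) : Set where
  field
    classes  : Family v
    nonempty : ∀ {C} → C ∈ᶠ classes → Nonempty C
    class    : ∀ (p : Fin v) → ∃! _≡_ λ C → C ∈ᶠ classes × p ∈ C

open Partition public

NonTrivial : Partition v → Set
NonTrivial ℭ = 1 < length (members (classes ℭ))
             × (∀ {C} → C ∈ᶠ classes ℭ → 1 < ∣ C ∣)

Invariant : Pred (Permutation′ v) ℓ → Partition v → Set ℓ
Invariant G ℭ = ∀ {g} → G g → ∀ {C} → C ∈ᶠ classes ℭ → image g C ∈ᶠ classes ℭ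

_Refines_ : Partition v → Partition v → Set
𝔇 Refines ℭ = ∀ {D} → D ∈ᶠ classes 𝔇 → ∃[ C ] C ∈ᶠ classes ℭ × D ⊆ C

_SameAs_ : Partition v → Partition v → Set
𝔇 SameAs ℭ = members (classes 𝔇) ∼[ set ] members (classes ℭ)

_StrictlyRefines_ : Partition v → Partition v → Set
𝔇 StrictlyRefines ℭ = 𝔇 Refines ℭ × ¬ 𝔇 SameAs ℭ

Minimal : Pred (Permutation′ v) ℓ → Partition v → Set ℓ
Minimal G ℭ = ¬ (∃[ 𝔇 ] NonTrivial 𝔇 × Invariant G 𝔇 × 𝔇 StrictlyRefines ℭ)

Maximal : Pred (Permutation′ v) ℓ → Partition v → Set ℓ
Maximal G ℭ = ¬ (∃[ 𝔇 ] NonTrivial 𝔇 × Invariant G 𝔇 × ℭ StrictlyRefines 𝔇)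

TwoStepImprimitive : Pred (Permutation′ v) ℓ → Partition v → Set ℓ
TwoStepImprimitive G ℭ = Minimal G ℭ × Maximal G ℭ

{-# OPTIONS --safe #-}

-- Let c < c′ be the class sizes of two invariant partitions, one strictly
-- refining the other.  Counting the pairs of points of a line that lie in a
-- common class gives  r · 2t = k (c − 1)  with integral t (Delandtsheer–Doyen),
-- and likewise for c′.  Put κ = gcd k r, k = s κ, r = R κ.  Since s and R are
-- coprime, R divides c − 1 and c′ − 1; as R also divides v − 1 = r (k − 1),
-- v is a product of three factors 1 + R aᵢ with aᵢ ≥ 1.  Hence
--   κ² s = κ + (a₁ + a₂ + a₃) + R (a₁ a₂ + a₁ a₃ + a₂ a₃) + R² a₁ a₂ a₃,
-- while s ≤ R by Fisher's inequality, so R a₁ a₂ a₃ ≤ κ² ≤ 64.  None of the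
-- finitely many remaining cases satisfies the equation together with the
-- coprimality of s and R and the integrality of t for c and c′.

module Submission where

open import Defs
open import Data.Bool.Base using (Bool; true; false)
open import Data.Empty using (⊥)
open import Data.Fin.Base using (Fin; zero; suc; fromℕ<)
open import Data.Fin.Permutation using (Permutation′; _⟨$⟩ʳ_; inverseˡ)
import Data.Fin.Properties as Fin
open import Data.Fin.Subset using (Subset; _∈_; _∉_; ∣_∣; ⁅_⁆; ⊤) renaming (_⊆_ to _⊆ₛ_)
open import Data.Fin.Subset.Properties using (_∈?_; x∈⁅x⁆; x≢y⇒x∉⁅y⁆; x∉⁅y⁆⇒x≢y; ∣⁅x⁆∣≡1; p⊂q⇒∣p∣<∣q∣; p⊆q⇒∣p∣≤∣q∣; ∣p∣≡n⇒p≡⊤; ∣⊤∣≡n; ∣p∣≤n; ⊆-antisym)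
open import Data.List.Base as List using (List; []; _∷_; length; filter)
open import Data.List.Membership.Propositional using () renaming (_∈_ to _∈ₗ_)
open import Data.List.Membership.Propositional.Properties using (∈-lookup)
open import Data.List.Relation.Unary.All as All using ()
open import Data.List.Relation.Unary.AllPairs using (_∷_)
open import Data.List.Relation.Unary.Any using (here; there)
open import Data.List.Relation.Unary.Unique.Propositional using (Unique)
open import Data.Nat.Base using (ℕ; zero; suc; pred; _+_; _*_; _<_; _≤_; z≤n; s≤s; z<s; NonZero; >-nonZero; ≢-nonZero; ≢-nonZero⁻¹)
open import Data.Nat.Coprimality as Coprimality using (Coprime; coprime-/gcd; coprime-divisor)
open import Data.Nat.Divisibility
open import Data.Nat.DivMod using (_/_; m*n/n≡m; m/n*n≡m; /-monoˡ-≤)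
open import Data.Nat.GCD using (gcd; gcd[m,n]∣m; gcd[m,n]∣n; gcd[m,n]≢0)
open import Data.Nat.Properties
open import Data.Nat.Tactic.RingSolver using (solve-∀)
open import Data.Product using (_×_; _,_; ∃-syntax; proj₁; proj₂)
open import Data.Sum using (inj₁)
open import Data.Vec.Base using (lookup; []; _∷_)
open import Data.Vec.Properties using ([]=⇒lookup; lookup⇒[]=; lookup∘tabulate)
open import Function using (_∘_; mk⇔)
open import Level using (Level)
open import Relation.Binary.PropositionalEquality using (_≡_; _≢_; refl; sym; trans; cong; cong₂; subst; module ≡-Reasoning)
open import Relation.Nullary using (Dec; yes; no; does; ¬_; contradiction)
open import Relation.Nullary.Decidable using (¬?; _×-dec_; toWitness; dec-true; dec-false)
open import Relation.Unary using (Pred; _⊆_)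
import Algebra.Properties.Semiring.Sum +-*-semiring as Σ
open Σ using (sum)

private
  variable
    v n : ℕ

-- The arithmetic of a chain of invariant partitions

-- (1 + R a)(1 + R b) = 1 + R · compound R a b
compound : ℕ → ℕ → ℕ → ℕ
compound R a b = a + b + R * a * b

-- κ² s expressed through the factorisation v = (1 + R a₁)(1 + R a₂)(1 + R a₃)
excess : ℕ → ℕ → ℕ → ℕ → ℕ → ℕ
excess κ R a₁ a₂ a₃ = κ + compound R (compound R a₁ a₂) a₃

-- With `c = 1 + R a₁` the relation `R · 2t = s (c − 1)` becomes `2t = s a₁`, and likewise for
-- `c′ = 1 + R · compound R a₁ a₂`; this is the source of the two evenness conditions. Coprimality
-- of `s` and `R` is recorded at the prime 2.
Admissible : (κ R a₁ a₂ a₃ s : ℕ) → Set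
Admissible κ R a₁ a₂ a₃ s =
  s * (κ * κ) ≡ excess κ R a₁ a₂ a₃ × s ≤ R
  × (2 ∣ s * a₁) × (2 ∣ s * compound R a₁ a₂) × ¬ ((2 ∣ s) × (2 ∣ R))

admissible? : ∀ κ R a₁ a₂ a₃ s → Dec (Admissible κ R a₁ a₂ a₃ s)
admissible? κ R a₁ a₂ a₃ s =
  (_ ≟ _) ×-dec (_ ≤? _) ×-dec (2 ∣? _) ×-dec (2 ∣? _) ×-dec
  ¬? ((2 ∣? _) ×-dec (2 ∣? _))

-- Arguments are predecessors of the actual parameters; s is forced to be excess / κ².
Excluded : ℕ → ℕ → ℕ → ℕ → ℕ → Set
Excluded κ R a₁ a₂ a₃ =
  ¬ Admissible (suc κ) (suc R) (suc a₁) (suc a₂) (suc a₃)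
      (excess (suc κ) (suc R) (suc a₁) (suc a₂) (suc a₃) / (suc κ * suc κ))

excluded? : ∀ κ R a₁ a₂ a₃ → Dec (Excluded κ R a₁ a₂ a₃)
excluded? κ R a₁ a₂ a₃ = ¬? (admissible? (suc κ) (suc R) (suc a₁) (suc a₂) (suc a₃)
  (excess (suc κ) (suc R) (suc a₁) (suc a₂) (suc a₃) / (suc κ * suc κ)))

-- Each bound is `N` divided by the product of the parameters already chosen, so exactly the tuples
-- with `R a₁ a₂ a₃ ≤ N` are visited.
SearchRange : ℕ → ℕ → Set
SearchRange K N =
         ∀ {κ} → κ < K → ∀ {R} → R < N →
         ∀ {a₁} → a₁ < N / suc R →
         ∀ {a₂} → a₂ < N / (suc R * suc a₁) →
         ∀ {a₃} → a₃ < N / (suc R * suc a₁ * suc a₂) →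
         Excluded κ R a₁ a₂ a₃

search? : ∀ K N → Dec (SearchRange K N)
search? K N =
  allUpTo? (λ κ → allUpTo? (λ R → allUpTo? (λ a₁ → allUpTo? (λ a₂ → allUpTo? (λ a₃ →
    excluded? κ R a₁ a₂ a₃)
    (N / (suc R * suc a₁ * suc a₂))) (N / (suc R * suc a₁))) (N / suc R)) N) K

-- Settled by evaluating the decision procedure during type checking. Here 8 bounds `κ`, and
-- `64 = 8²` bounds `R a₁ a₂ a₃`.
search : SearchRange 8 64
search = toWitness {a? = search? 8 64} _

m*n≤o⇒m≤o/n : ∀ m n {o} .{{_ : NonZero n}} → m * n ≤ o → m ≤ o / n
m*n≤o⇒m≤o/n m n m*n≤o = subst (_≤ _) (m*n/n≡m m n) (/-monoˡ-≤ n m*n≤o)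

-- Keeps only the leading term. Its second factor `R` is the one that cancels against `s ≤ R`, which
-- makes the search finite.
excess-lower : ∀ κ R a₁ a₂ a₃ → R * a₁ * a₂ * a₃ * R ≤ excess κ R a₁ a₂ a₃
excess-lower κ R a₁ a₂ a₃ = subst (R * a₁ * a₂ * a₃ * R ≤_) (expand κ R a₁ a₂ a₃)
                              (m≤m+n _ _)
  where
  expand : ∀ κ R a₁ a₂ a₃ →
    R * a₁ * a₂ * a₃ * R + (κ + (a₁ + a₂ + R * a₁ * a₂ + a₃ + R * (a₁ + a₂) * a₃))
    ≡ κ + (a₁ + a₂ + R * a₁ * a₂ + a₃ + R * (a₁ + a₂ + R * a₁ * a₂) * a₃)
  expand = solve-∀

inadmissible : ∀ κ R a₁ a₂ a₃ {s} .{{_ : NonZero κ}} .{{_ : NonZero R}}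
               .{{_ : NonZero a₁}} .{{_ : NonZero a₂}} .{{_ : NonZero a₃}} →
               κ ≤ 8 → ¬ Admissible κ R a₁ a₂ a₃ s
inadmissible κ@(suc _) R@(suc _) a₁@(suc _) a₂@(suc _) a₃@(suc _) {s} κ≤8
  adm@(eq , s≤R , _) =
  -- A strict bound on a predecessor is by definition a weak bound on the parameter itself. All
  -- bounds after the first come from `R a₁ a₂ a₃ ≤ 64` by dropping later factors, which are
  -- positive.
  search κ≤8 (≤-trans (m≤m*n R (a₁ * a₂ * a₃)) (subst (_≤ 64) (reassoc R a₁ a₂ a₃) bound))
    (below a₁ R (≤-trans (m≤m*n (R * a₁) (a₂ * a₃)) (subst (_≤ 64) (reassoc′ R a₁ a₂ a₃) bound)))
    (below a₂ (R * a₁) (≤-trans (m≤m*n (R * a₁ * a₂) a₃) bound))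
    (below a₃ (R * a₁ * a₂) bound)
    (subst (Admissible κ R a₁ a₂ a₃) s≡ adm)
  where
  s≡ : s ≡ excess κ R a₁ a₂ a₃ / (κ * κ)
  s≡ = trans (sym (m*n/n≡m s (κ * κ))) (cong (_/ (κ * κ)) eq)
  bound : R * a₁ * a₂ * a₃ ≤ 64
  bound = *-cancelʳ-≤ _ _ R (begin
    R * a₁ * a₂ * a₃ * R    ≤⟨ excess-lower κ R a₁ a₂ a₃ ⟩
    excess κ R a₁ a₂ a₃     ≡⟨ eq ⟨
    s * (κ * κ)             ≤⟨ *-mono-≤ s≤R (*-mono-≤ κ≤8 κ≤8) ⟩
    R * 64                  ≡⟨ *-comm R 64 ⟩
    64 * R                  ∎)
    where open ≤-Reasoning
  reassoc : ∀ R a b c → R * a * b * c ≡ R * (a * b * c)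
  reassoc = solve-∀
  reassoc′ : ∀ R a b c → R * a * b * c ≡ R * a * (b * c)
  reassoc′ = solve-∀
  below : ∀ a n .{{_ : NonZero n}} → n * a ≤ 64 → a ≤ 64 / n
  below a n le = m*n≤o⇒m≤o/n a n (subst (_≤ 64) (*-comm n a) le)

-- Modulo `R` both the product and one factor are 1, hence so is the other factor:
-- `m = n′ + n (n′ + 1)`.
∣-excess : ∀ {R m n n′} → suc m ≡ suc n * suc n′ → R ∣ m → R ∣ n → R ∣ n′
∣-excess {R} {m} {n} {n′} eq R∣m R∣n =
  ∣m+n∣m⇒∣n (subst (R ∣_) (trans (suc-injective eq) (+-comm n′ _)) R∣m)
            (∣m⇒∣m*n (suc n′) R∣n)

compound-factor : ∀ R a b c .{{_ : NonZero R}} →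
  suc (c * R) ≡ suc (a * R) * suc (b * R) → c ≡ compound R a b
compound-factor R a b c eq = *-cancelʳ-≡ c _ R
  (trans (suc-injective eq) (expand R a b))
  where
  expand : ∀ R a b → b * R + a * R * suc (b * R) ≡ (a + b + R * a * b) * R
  expand = solve-∀

coprime⇒¬bothEven : ∀ {m n} → Coprime m n → ¬ ((2 ∣ m) × (2 ∣ n))
coprime⇒¬bothEven coprime 2∣m,n with coprime 2∣m,n
... | ()

-- Dictionary: `c = suc n₁`, `c′ = suc n`, `c′ / c = suc n₂`, `v / c′ = suc n₃`, `k = s κ`,
-- `r = R κ`, with `κ` already cancelled from the two pair counts.
coprime-chain-impossible : ∀ {κ s R k-1 n₁ n₂ n₃ n t t′}
  .{{_ : NonZero κ}} .{{_ : NonZero R}}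
  .{{_ : NonZero n₁}} .{{_ : NonZero n₂}} .{{_ : NonZero n₃}} →
  κ ≤ 8 → s ≤ R → Coprime s R → s * κ ≡ suc k-1 →
  R * (2 * t) ≡ s * n₁ → R * (2 * t′) ≡ s * n →
  suc n ≡ suc n₁ * suc n₂ → suc (R * κ * k-1) ≡ suc n * suc n₃ → ⊥
coprime-chain-impossible {κ} {s} {R} {k-1} {n₁} {n₂} {n₃} {n}
  κ≤8 s≤R coprime sκ≡k inner₁ inner n≡ v≡
  with R∣ inner₁ | R∣ inner
  where
  R∣ : ∀ {t m} → R * t ≡ s * m → R ∣ m
  R∣ {t} eq = coprime-divisor (Coprimality.sym coprime) (subst (R ∣_) eq (m∣m*n t))
... | R∣n₁ | R∣n
  -- Divisibility by `R` passes to the cofactors `c′ / c` and `v / c′`, each diminished by 1; for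
  -- the latter, `R` divides `v − 1 = R κ (k − 1)`.
  with ∣-excess {n′ = n₂} n≡ R∣n R∣n₁
     | ∣-excess {n′ = n₃} v≡ (∣m⇒∣m*n k-1 (m∣m*n κ)) R∣n
coprime-chain-impossible {κ} {s} {R} {k-1} {t = t} {t′}
  κ≤8 s≤R coprime sκ≡k inner₁ inner n≡ v≡
  | divides a₁ refl | divides a refl | divides a₂ refl | divides a₃ refl =
  inadmissible κ R a₁ a₂ a₃ κ≤8
    ( s-equation , s≤R , even {t} a₁ inner₁
    , subst (λ a → 2 ∣ s * a) a≡ (even {t′} a inner) , coprime⇒¬bothEven coprime)
  where
  instance
    a₁≢0 : NonZero a₁
    a₁≢0 = m*n≢0⇒m≢0 a₁
    a₂≢0 : NonZero a₂
    a₂≢0 = m*n≢0⇒m≢0 a₂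
    a₃≢0 : NonZero a₃
    a₃≢0 = m*n≢0⇒m≢0 a₃
  even : ∀ {t} a → R * (2 * t) ≡ s * (a * R) → 2 ∣ s * a
  even {t} a eq = divides t (*-cancelˡ-≡ _ _ R (begin
    R * (s * a)  ≡⟨ rotate R s a ⟩
    s * (a * R)  ≡⟨ eq ⟨
    R * (2 * t)  ≡⟨ cong (R *_) (*-comm 2 t) ⟩
    R * (t * 2)  ∎))
    where
    open ≡-Reasoning
    rotate : ∀ a b c → a * (b * c) ≡ b * (c * a)
    rotate = solve-∀
  a≡ : a ≡ compound R a₁ a₂
  a≡ = compound-factor R a₁ a₂ a n≡
  κk-1≡ : κ * k-1 ≡ compound R a a₃
  κk-1≡ = compound-factor R a a₃ (κ * k-1) (trans (cong suc (rotate κ k-1 R)) v≡)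
    where
    rotate : ∀ a b c → a * b * c ≡ c * a * b
    rotate = solve-∀
  -- `s κ² = k κ = κ + κ (k − 1)`, and `κ (k − 1) = (v − 1) / R` is the compound of the three `aᵢ`.
  s-equation : s * (κ * κ) ≡ excess κ R a₁ a₂ a₃
  s-equation = begin
    s * (κ * κ)                              ≡⟨ *-assoc s κ κ ⟨
    s * κ * κ                                ≡⟨ cong (_* κ) sκ≡k ⟩
    κ + k-1 * κ                              ≡⟨ cong (κ +_) (*-comm k-1 κ) ⟩
    κ + κ * k-1                              ≡⟨ cong (κ +_) κk-1≡ ⟩
    κ + compound R a a₃                      ≡⟨ cong (λ a → κ + compound R a a₃) a≡ ⟩
    excess κ R a₁ a₂ a₃                      ∎
    where open ≡-Reasoning

-- The gcd and the quotients are hidden behind existentials so that the equations for `k` and `r`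
-- can later be matched with `refl`.
lowest-terms : ∀ k r .{{_ : NonZero k}} →
  ∃[ κ ] ∃[ s ] ∃[ R ] κ ≡ gcd k r × k ≡ s * κ × r ≡ R * κ × Coprime s R
lowest-terms k r =
  gcd k r , k / gcd k r , r / gcd k r , refl ,
  sym (m/n*n≡m (gcd[m,n]∣m k r)) , sym (m/n*n≡m (gcd[m,n]∣n k r)) , coprime-/gcd k r
  where
  instance
    gcd≢0 : NonZero (gcd k r)
    gcd≢0 = ≢-nonZero (gcd[m,n]≢0 k r (inj₁ (≢-nonZero⁻¹ k)))

-- Cancelling `κ` turns `k ≤ r` into `s ≤ R` and reduces both pair counts to `s` and `R`; strictness
-- of the chain makes both cofactors exceed 1.
chain-impossible : ∀ {k r v c c′ t t′} → 2 < k → k ≤ r → gcd k r ≤ 8 →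
  1 < c → c < c′ → c′ < v → c ∣ c′ → c′ ∣ v →
  r * (2 * t) ≡ k * pred c → r * (2 * t′) ≡ k * pred c′ →
  v ≡ suc (r * pred k) → ⊥
chain-impossible {k} {r} 2<k _ _ _ _ _ _ _ _ _ _
  with lowest-terms k r {{>-nonZero (<-trans z<s 2<k)}}
chain-impossible {c = suc n₁@(suc _)} {c′@(suc n)} {t} {t′}
  2<k k≤r gcd≤8 (s≤s (s≤s _)) c<c′ c′<v c∣c′ c′∣v inner₁ inner v≡
  | κ , s , R , κ≡ , refl , refl , coprime
  with quotient c∣c′ | quotient>1 c∣c′ c<c′ | m∣n⇒n≡m*quotient c∣c′
     | quotient c′∣v | quotient>1 c′∣v c′<v | m∣n⇒n≡m*quotient c′∣v
... | suc _ | s≤s (s≤s _) | c′≡ | suc _ | s≤s (s≤s _) | v≡c′* =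
  coprime-chain-impossible {t = t} {t′} (subst (_≤ 8) (sym κ≡) gcd≤8)
    (*-cancelʳ-≤ s R κ k≤r) coprime
    (sym (suc-pred (s * κ)))
    (reduce inner₁) (reduce inner) c′≡ (trans (sym v≡) v≡c′*)
  where
  instance
    k≢0 : NonZero (s * κ)
    k≢0 = >-nonZero (<-trans z<s 2<k)
    r≢0 : NonZero (R * κ)
    r≢0 = >-nonZero (<-≤-trans (<-trans z<s 2<k) k≤r)
    κ≢0 : NonZero κ
    κ≢0 = m*n≢0⇒n≢0 s
    R≢0 : NonZero R
    R≢0 = m*n≢0⇒m≢0 R
  reduce : ∀ {t m} → R * κ * t ≡ s * κ * m → R * t ≡ s * m
  reduce {t} {m} eq = *-cancelʳ-≡ _ _ κ
    (trans (exchange R t κ) (trans eq (exchange s κ m)))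
    where
    exchange : ∀ a b c → a * b * c ≡ a * c * b
    exchange = solve-∀

-- Finite sums

sum-const : ∀ n c → sum {n} (λ _ → c) ≡ n * c
sum-const zero    c = refl
sum-const (suc n) c = cong (c +_) (sum-const n c)

sum-zero : (f : Fin n → ℕ) → (∀ i → f i ≡ 0) → sum f ≡ 0
sum-zero {n} f f≡0 = trans (Σ.sum-cong-≗ f≡0) (trans (sum-const n 0) (*-zeroʳ n))

sum-point : (f : Fin n → ℕ) (i : Fin n) → (∀ j → j ≢ i → f j ≡ 0) → sum f ≡ f i
sum-point f zero    f≡0 =
  trans (cong (f zero +_) (sum-zero (f ∘ suc) λ j → f≡0 (suc j) λ ())) (+-identityʳ _)
sum-point f (suc i) f≡0 =
  cong₂ _+_ (f≡0 zero λ ()) (sum-point (f ∘ suc) i λ j j≢i → f≡0 (suc j) (j≢i ∘ Fin.suc-injective))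

sum-mono : {f g : Fin n → ℕ} → (∀ i → f i ≤ g i) → sum f ≤ sum g
sum-mono {zero}  f≤g = z≤n
sum-mono {suc n} f≤g = +-mono-≤ (f≤g zero) (sum-mono (f≤g ∘ suc))

sum-∣ : ∀ {d} (f : Fin n → ℕ) → (∀ i → d ∣ f i) → d ∣ sum f
sum-∣ {zero}  f d∣f = _ ∣0
sum-∣ {suc n} f d∣f = ∣m∣n⇒∣m+n (d∣f zero) (sum-∣ (f ∘ suc) (d∣f ∘ suc))

-- Vanishing products leave at most one index with a nonzero value. Used for the common points of
-- two lines.
sum≤1 : (f : Fin n → ℕ) → (∀ i → f i ≤ 1) → (∀ i j → i ≢ j → f i * f j ≡ 0) → sum f ≤ 1
sum≤1 {zero}  f f≤1 disjoint = z≤n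
sum≤1 {suc n} f f≤1 disjoint with f zero in f₀ | f≤1 zero
... | zero  | _  = sum≤1 (f ∘ suc) (f≤1 ∘ suc)
                     λ i j i≢j → disjoint (suc i) (suc j) (i≢j ∘ Fin.suc-injective)
... | suc zero | _ = ≤-reflexive (cong suc (sum-zero (f ∘ suc)
                     λ i → trans (sym (trans (cong (_* f (suc i)) f₀) (*-identityˡ _)))
                                 (disjoint zero (suc i) λ ())))
... | suc (suc _) | s≤s ()

-- Off-diagonal terms pair up: the induction removes the first row together with the equal first
-- column. This supplies the integrality of `t`.
symmetric-sum : (s : Fin n → Fin n → ℕ) → (∀ i j → s i j ≡ s j i) →
  ∃[ t ] sum (λ i → sum (s i)) ≡ sum (λ i → s i i) + 2 * t
symmetric-sum {zero}  s symm = 0 , refl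
symmetric-sum {suc n} s symm
  with t , eq ← symmetric-sum (λ i j → s (suc i) (suc j)) (λ i j → symm (suc i) (suc j)) =
  row + t , (begin
    s zero zero + row + sum (λ i → s (suc i) zero + sum (λ j → s (suc i) (suc j)))
      ≡⟨ cong (s zero zero + row +_) (Σ.∑-distrib-+ (λ i → s (suc i) zero) _) ⟩
    s zero zero + row + (sum (λ i → s (suc i) zero) + rest)
      ≡⟨ cong₂ (λ c d → s zero zero + row + (c + d)) (Σ.sum-cong-≗ λ i → symm (suc i) zero) eq ⟩
    s zero zero + row + (row + (diagonal + 2 * t))
      ≡⟨ regroup (s zero zero) row diagonal t ⟩
    s zero zero + diagonal + 2 * (row + t) ∎)
  where
  open ≡-Reasoning
  row = sum (λ j → s zero (suc j))
  rest = sum (λ i → sum (λ j → s (suc i) (suc j)))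
  diagonal = sum (λ i → s (suc i) (suc i))
  regroup : ∀ a b c d → a + b + (b + (c + 2 * d)) ≡ a + c + 2 * (b + d)
  regroup = solve-∀

-- Characteristic functions

bit : Bool → ℕ
bit true  = 1
bit false = 0

bit-true : ∀ {a} {A : Set a} (A? : Dec A) → A → bit (does A?) ≡ 1
bit-true A? a = cong bit (dec-true A? a)

bit-false : ∀ {a} {A : Set a} (A? : Dec A) → ¬ A → bit (does A?) ≡ 0
bit-false A? ¬a = cong bit (dec-false A? ¬a)

χ : Subset v → Fin v → ℕ
χ B p = bit (lookup B p)

χ-∈ : ∀ {B : Subset v} {p} → p ∈ B → χ B p ≡ 1
χ-∈ p∈B = cong bit ([]=⇒lookup p∈B)

χ-∉ : ∀ {B : Subset v} {p} → p ∉ B → χ B p ≡ 0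
χ-∉ {B = B} {p} p∉B with lookup B p in eq
... | true  = contradiction (lookup⇒[]= p B eq) p∉B
... | false = refl

χ≢0⇒∈ : ∀ {B : Subset v} {p} → χ B p ≢ 0 → p ∈ B
χ≢0⇒∈ {B = B} {p} χ≢0 with p ∈? B
... | yes p∈B = p∈B
... | no  p∉B = contradiction (χ-∉ p∉B) χ≢0

χ-cong : ∀ {B C : Subset v} {p q} → (p ∈ B → q ∈ C) → (q ∈ C → p ∈ B) → χ B p ≡ χ C q
χ-cong {B = B} {p = p} to from with p ∈? B
... | yes p∈B = trans (χ-∈ p∈B) (sym (χ-∈ (to p∈B)))
... | no  p∉B = trans (χ-∉ p∉B) (sym (χ-∉ (p∉B ∘ from)))

χ≤1 : ∀ (B : Subset v) p → χ B p ≤ 1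
χ≤1 B p with lookup B p
... | true  = ≤-refl
... | false = z≤n

χ-idem : ∀ (B : Subset v) p → χ B p * χ B p ≡ χ B p
χ-idem B p with lookup B p
... | true  = refl
... | false = refl

sum-χ : (B : Subset v) → sum (χ B) ≡ ∣ B ∣
sum-χ []            = refl
sum-χ (true ∷ B)  = cong suc (sum-χ B)
sum-χ (false ∷ B) = sum-χ B

χ-image : ∀ g (B : Subset v) p → χ (image g B) (g ⟨$⟩ʳ p) ≡ χ B p
χ-image g B p = cong bit (trans (lookup∘tabulate _ (g ⟨$⟩ʳ p)) (cong (lookup B) (inverseˡ g)))

∈-image : ∀ g {B : Subset v} {p} → p ∈ B → g ⟨$⟩ʳ p ∈ image g B
∈-image g {B} {p} p∈B = χ≢0⇒∈ λ χ≡0 →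
  1+n≢0 (trans (sym (χ-∈ p∈B)) (trans (sym (χ-image g B p)) χ≡0))

sum-image : ∀ g (B : Subset v) (w : Fin v → ℕ) → (∀ p → w (g ⟨$⟩ʳ p) ≡ w p) →
  sum (λ p → χ (image g B) p * w p) ≡ sum (λ p → χ B p * w p)
sum-image g B w inv = trans (Σ.sum-permute _ g)
  (Σ.sum-cong-≗ λ p → cong₂ _*_ (χ-image g B p) (inv p))

⊆∧∣∣≥⇒≡ : ∀ {B C : Subset v} → B ⊆ₛ C → ∣ C ∣ ≤ ∣ B ∣ → B ≡ C
⊆∧∣∣≥⇒≡ {B = B} {C} B⊆C ∣C∣≤∣B∣ = ⊆-antisym B⊆C C⊆B
  where
  C⊆B : C ⊆ₛ B
  C⊆B {x} x∈C with x ∈? B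
  ... | yes x∈B = x∈B
  ... | no  x∉B = contradiction ∣C∣≤∣B∣ (<⇒≱ (p⊂q⇒∣p∣<∣q∣ (B⊆C , x , x∈C , x∉B)))

∣∣<⇒∃∉ : ∀ {B : Subset v} → ∣ B ∣ < v → ∃[ p ] p ∉ B
∣∣<⇒∃∉ {v} {B} ∣B∣<v = Fin.¬∀⟶∃¬ v (_∈ B) (_∈? B)
  λ all → <-irrefl refl (<-≤-trans ∣B∣<v
    (subst (_≤ ∣ B ∣) (∣⊤∣≡n v) (p⊆q⇒∣p∣≤∣q∣ {p = ⊤} {q = B} λ {x} _ → all x)))

∣image∣ : ∀ g (B : Subset v) → ∣ image g B ∣ ≡ ∣ B ∣
∣image∣ g B = trans (sym (sum-χ (image g B)))
  (trans (Σ.sum-permute (χ (image g B)) g) (trans (Σ.sum-cong-≗ (χ-image g B)) (sum-χ B)))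

-- Sums over families

sumᶠ : Family v → (Subset v → ℕ) → ℕ
sumᶠ 𝓕 f = sum (λ i → f (List.lookup (members 𝓕) i))

sumᶠ-cong : ∀ (𝓕 : Family v) {f g : Subset v → ℕ} → (∀ {B} → B ∈ᶠ 𝓕 → f B ≡ g B) → sumᶠ 𝓕 f ≡ sumᶠ 𝓕 g
sumᶠ-cong 𝓕 f≡g = Σ.sum-cong-≗ λ i → f≡g (∈-lookup i)

-- Rests on the list being free of repetitions; otherwise `f B` would be counted with multiplicity.
sumᶠ-point : ∀ (𝓕 : Family v) {B} (f : Subset v → ℕ) → B ∈ᶠ 𝓕 →
  (∀ {C} → C ∈ᶠ 𝓕 → C ≢ B → f C ≡ 0) → sumᶠ 𝓕 f ≡ f B
sumᶠ-point 𝓕 f = go (members 𝓕) (unique 𝓕)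
  where
  go : ∀ Bs → Unique Bs → ∀ {B} → B ∈ₗ Bs → (∀ {C} → C ∈ₗ Bs → C ≢ B → f C ≡ 0) →
       sum (λ i → f (List.lookup Bs i)) ≡ f B
  go (B ∷ Bs) (B∉Bs ∷ _) (here refl) f≡0 =
    trans (cong (f B +_) (sum-zero _ λ i →
            f≡0 (there (∈-lookup i)) (All.lookup B∉Bs (∈-lookup i) ∘ sym)))
          (+-identityʳ _)
  go (C ∷ Bs) (C∉Bs ∷ uniq) (there B∈Bs) f≡0 =
    cong₂ _+_ (f≡0 (here refl) (All.lookup C∉Bs B∈Bs)) (go Bs uniq B∈Bs (f≡0 ∘ there))

sumᶠ-χ : ∀ (𝓕 : Family v) (p : Fin v) →
  sumᶠ 𝓕 (λ B → χ B p) ≡ length (filter (p ∈?_) (members 𝓕))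
sumᶠ-χ 𝓕 p = go (members 𝓕)
  where
  go : ∀ Bs → sum (λ i → χ (List.lookup Bs i) p) ≡ length (filter (p ∈?_) Bs)
  go [] = refl
  go (B ∷ Bs) with p ∈? B
  ... | yes p∈B = cong₂ _+_ (χ-∈ p∈B) (go Bs)
  ... | no  p∉B = cong₂ _+_ (χ-∉ p∉B) (go Bs)

sumᶠ-constant : ∀ (𝓕 : Family v) {c f} → (∀ {B} → B ∈ᶠ 𝓕 → f B ≡ c) → sumᶠ 𝓕 f ≡ length (members 𝓕) * c
sumᶠ-constant 𝓕 f≡c = trans (sumᶠ-cong 𝓕 f≡c) (sum-const (length (members 𝓕)) _)

sumᶠ-sum : ∀ (𝓕 : Family v) (f : Subset v → Fin n → ℕ) →
  sumᶠ 𝓕 (λ B → sum (f B)) ≡ sum (λ p → sumᶠ 𝓕 (λ B → f B p))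
sumᶠ-sum 𝓕 f = Σ.∑-comm (λ i p → f (List.lookup (members 𝓕) i) p)

*-distribʳ-sumᶠ : ∀ (𝓕 : Family v) c (f : Subset v → ℕ) → sumᶠ 𝓕 f * c ≡ sumᶠ 𝓕 (λ B → f B * c)
*-distribʳ-sumᶠ 𝓕 c f = Σ.*-distribʳ-sum {length (members 𝓕)} c _

-- Counting in linear spaces

module Counting {v k r : ℕ} (𝒮 : LinearSpace v)
  (line-size : ConstantLineSize 𝒮 k)
  (degree : ∀ p → length (linesThrough 𝒮 p) ≡ r) where

  b : ℕ
  b = length (members (lines 𝒮))

  line-unique : ∀ {p q L M} → p ≢ q → L ∈ᶠ lines 𝒮 → M ∈ᶠ lines 𝒮 →
    p ∈ L → q ∈ L → p ∈ M → q ∈ M → L ≡ M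
  line-unique p≢q L∈ M∈ p∈L q∈L p∈M q∈M with _ , _ , uniq ← join 𝒮 p≢q =
    trans (sym (uniq (L∈ , p∈L , q∈L))) (uniq (M∈ , p∈M , q∈M))

  pencil-size : ∀ p → sumᶠ (lines 𝒮) (λ L → χ L p) ≡ r
  pencil-size p = trans (sumᶠ-χ (lines 𝒮) p) (degree p)

  joining : ∀ {p q} → p ≢ q → sumᶠ (lines 𝒮) (λ L → χ L p * χ L q) ≡ 1
  joining {p} {q} p≢q with L , (L∈ , p∈L , q∈L) , uniq ← join 𝒮 p≢q =
    trans (sumᶠ-point (lines 𝒮) _ L∈ elsewhere) (cong₂ _*_ (χ-∈ p∈L) (χ-∈ q∈L))
    where
    elsewhere : ∀ {M} → M ∈ᶠ lines 𝒮 → M ≢ L → χ M p * χ M q ≡ 0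
    elsewhere {M} M∈ M≢L with p ∈? M | q ∈? M
    ... | no p∉M  | _ = cong (_* χ M q) (χ-∉ p∉M)
    ... | yes _   | no q∉M = trans (cong (χ M p *_) (χ-∉ q∉M)) (*-zeroʳ (χ M p))
    ... | yes p∈M | yes q∈M = contradiction (sym (uniq (M∈ , p∈M , q∈M))) M≢L

  -- A point q ≠ p lies on exactly one line through p, while p itself lies on all r of them.
  pencil : ∀ p (f : Fin v → ℕ) →
    sumᶠ (lines 𝒮) (λ L → χ L p * sum (λ q → χ L q * f q)) + f p ≡ sum f + r * f p
  pencil p f = begin
    sumᶠ (lines 𝒮) (λ L → χ L p * sum (λ q → χ L q * f q)) + f p
      ≡⟨ cong (_+ f p) (sumᶠ-cong (lines 𝒮) {λ L → χ L p * sum (λ q → χ L q * f q)}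
           λ {L} _ → trans (Σ.*-distribˡ-sum {v} (χ L p) _)
             (Σ.sum-cong-≗ {v} λ q → sym (*-assoc (χ L p) (χ L q) (f q)))) ⟩
    sumᶠ (lines 𝒮) (λ L → sum (λ q → χ L p * χ L q * f q)) + f p
      ≡⟨ cong₂ _+_ (sumᶠ-sum (lines 𝒮) (λ L q → χ L p * χ L q * f q)) (sym at-p) ⟩
    sum (λ q → sumᶠ (lines 𝒮) (λ L → χ L p * χ L q * f q)) + sum (λ q → χ ⁅ p ⁆ q * f q)
      ≡⟨ Σ.∑-distrib-+ {v} _ _ ⟨
    sum (λ q → sumᶠ (lines 𝒮) (λ L → χ L p * χ L q * f q) + χ ⁅ p ⁆ q * f q)
      ≡⟨ Σ.sum-cong-≗ (λ q → trans (cong (_+ χ ⁅ p ⁆ q * f q)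
            (sym (*-distribʳ-sumᶠ (lines 𝒮) (f q) (λ L → χ L p * χ L q)))) (pointwise q)) ⟩
    sum (λ q → f q + r * (χ ⁅ p ⁆ q * f q))
      ≡⟨ Σ.∑-distrib-+ {v} _ _ ⟩
    sum f + sum (λ q → r * (χ ⁅ p ⁆ q * f q))
      ≡⟨ cong (sum f +_) (Σ.*-distribˡ-sum {v} r _) ⟨
    sum f + r * sum (λ q → χ ⁅ p ⁆ q * f q)
      ≡⟨ cong (λ m → sum f + r * m) at-p ⟩
    sum f + r * f p ∎
    where
    open ≡-Reasoning
    -- Writing `f p` as a sum against the indicator of `p` reduces the identity to a comparison for
    -- each `q`, with coefficient `r + 1` at `p` and 1 elsewhere.
    at-p : sum (λ q → χ ⁅ p ⁆ q * f q) ≡ f p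
    at-p = trans (sum-point _ p λ q q≢p → cong (_* f q) (χ-∉ (x≢y⇒x∉⁅y⁆ q≢p)))
                 (trans (cong (_* f p) (χ-∈ (x∈⁅x⁆ p))) (*-identityˡ (f p)))
    pointwise : ∀ q → sumᶠ (lines 𝒮) (λ L → χ L p * χ L q) * f q + χ ⁅ p ⁆ q * f q
                      ≡ f q + r * (χ ⁅ p ⁆ q * f q)
    pointwise q with p Fin.≟ q
    ... | yes refl
      rewrite χ-∈ (x∈⁅x⁆ p) | *-identityˡ (f p)
            | trans (sumᶠ-cong (lines 𝒮) (λ {L} _ → χ-idem L p)) (pencil-size p) = +-comm (r * f p) (f p)
    ... | no p≢q
      rewrite joining p≢q | χ-∉ (x≢y⇒x∉⁅y⁆ (p≢q ∘ sym)) | *-zeroʳ r = cong (_+ 0) (*-identityˡ (f q))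

  line-sum : ∀ {L} → L ∈ᶠ lines 𝒮 → sum (χ L) ≡ k
  line-sum {L} L∈ = trans (sum-χ L) (line-size L∈)

  -- Double counting of incident point-line pairs.
  flags : b * k ≡ v * r
  flags = begin
    b * k                                       ≡⟨ sumᶠ-constant (lines 𝒮) line-sum ⟨
    sumᶠ (lines 𝒮) (λ L → sum (χ L))            ≡⟨ sumᶠ-sum (lines 𝒮) χ ⟩
    sum (λ p → sumᶠ (lines 𝒮) (λ L → χ L p))    ≡⟨ Σ.sum-cong-≗ pencil-size ⟩
    sum {v} (λ _ → r)                           ≡⟨ sum-const v r ⟩
    v * r                                       ∎
    where open ≡-Reasoning

  -- The form of `pencil` for weights with equal line sums, as line-transitivity produces them: the
  -- dependence on the point is now only through `f p`.
  pencil-constant : ∀ p (f : Fin v → ℕ) {m} →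
    (∀ {L} → L ∈ᶠ lines 𝒮 → sum (λ q → χ L q * f q) ≡ m) →
    r * m + f p ≡ sum f + r * f p
  pencil-constant p f {m} constant = trans (cong (_+ f p) (sym (begin
    sumᶠ (lines 𝒮) (λ L → χ L p * sum (λ q → χ L q * f q))
      ≡⟨ sumᶠ-cong (lines 𝒮) (λ {L} L∈ → cong (χ L p *_) (constant L∈)) ⟩
    sumᶠ (lines 𝒮) (λ L → χ L p * m)
      ≡⟨ *-distribʳ-sumᶠ (lines 𝒮) m (λ L → χ L p) ⟨
    sumᶠ (lines 𝒮) (λ L → χ L p) * m
      ≡⟨ cong (_* m) (pencil-size p) ⟩
    r * m ∎))) (pencil p f)
    where open ≡-Reasoning

  -- The weight 1 in `pencil-constant` gives `r k + 1 = v + r`.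
  points : .{{_ : NonZero k}} → Fin v → v ≡ suc (r * pred k)
  points p = +-cancelʳ-≡ r v _ (begin
    v + r                  ≡⟨ cong₂ _+_ (trans (sum-const v 1) (*-identityʳ v)) (*-identityʳ r) ⟨
    sum {v} (λ _ → 1) + r * 1 ≡⟨ pencil-constant p (λ _ → 1) (λ {L} L∈ →
                                 trans (Σ.sum-cong-≗ (λ q → *-identityʳ (χ L q))) (line-sum L∈)) ⟨
    r * k + 1              ≡⟨ cong (λ m → r * m + 1) (suc-pred k) ⟨
    r * suc (pred k) + 1   ≡⟨ expand r (pred k) ⟩
    suc (r * pred k) + r   ∎)
    where
    open ≡-Reasoning
    expand : ∀ a b → a * suc b + 1 ≡ suc (a * b) + a
    expand = solve-∀

  -- By `pencil` for the indicator of `L`, the `r` lines through `p` together cover the `k` points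
  -- of `L`, and each meets `L` at most once.
  fisher : ∀ {L p} → L ∈ᶠ lines 𝒮 → p ∉ L → k ≤ r
  fisher {L} {p} L∈ p∉L = begin
    k                                                             ≡⟨ line-sum L∈ ⟨
    sum (χ L)                                                     ≡⟨ +-identityʳ _ ⟨
    sum (χ L) + 0                                                 ≡⟨ cong (sum (χ L) +_) (*-zeroʳ r) ⟨
    sum (χ L) + r * 0                                             ≡⟨ cong (λ m → sum (χ L) + r * m) (χ-∉ p∉L) ⟨
    sum (χ L) + r * χ L p                                         ≡⟨ pencil p (χ L) ⟨
    sumᶠ (lines 𝒮) (λ M → χ M p * sum (λ q → χ M q * χ L q)) + χ L p ≡⟨ cong (sumᶠ (lines 𝒮) (λ M → χ M p * sum (λ q → χ M q * χ L q)) +_) (χ-∉ p∉L) ⟩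
    sumᶠ (lines 𝒮) (λ M → χ M p * sum (λ q → χ M q * χ L q)) + 0  ≡⟨ +-identityʳ _ ⟩
    sumᶠ (lines 𝒮) (λ M → χ M p * sum (λ q → χ M q * χ L q))      ≤⟨ sum-mono (λ i → meets-once (∈-lookup i)) ⟩
    sumᶠ (lines 𝒮) (λ M → χ M p)                                  ≡⟨ pencil-size p ⟩
    r                                                             ∎
    where
    open ≤-Reasoning
    common : ∀ {M} → M ∈ᶠ lines 𝒮 → p ∈ M → ∀ i j → i ≢ j →
             (χ M i * χ L i) * (χ M j * χ L j) ≡ 0
    common {M} M∈ p∈M i j i≢j with i ∈? M | i ∈? L | j ∈? M | j ∈? L
    ... | no i∉M | _ | _ | _ = cong (λ m → m * χ L i * (χ M j * χ L j)) (χ-∉ i∉M)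
    ... | yes _ | no i∉L | _ | _ =
      cong (_* (χ M j * χ L j)) (trans (cong (χ M i *_) (χ-∉ i∉L)) (*-zeroʳ (χ M i)))
    ... | yes _ | yes _ | no j∉M | _ =
      trans (cong (λ m → χ M i * χ L i * (m * χ L j)) (χ-∉ j∉M)) (*-zeroʳ (χ M i * χ L i))
    ... | yes _ | yes _ | yes _ | no j∉L =
      trans (cong (χ M i * χ L i *_) (trans (cong (χ M j *_) (χ-∉ j∉L)) (*-zeroʳ (χ M j))))
            (*-zeroʳ (χ M i * χ L i))
    -- Two common points would give `M ≡ L` and so put `p` on `L`.
    ... | yes i∈M | yes i∈L | yes j∈M | yes j∈L =
      contradiction (subst (p ∈_) (line-unique i≢j M∈ L∈ i∈M j∈M i∈L j∈L) p∈M) p∉L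
    meets-once : ∀ {M} → M ∈ᶠ lines 𝒮 → χ M p * sum (λ q → χ M q * χ L q) ≤ χ M p
    meets-once {M} M∈ with p ∈? M
    ... | no  p∉M rewrite χ-∉ p∉M = z≤n
    ... | yes p∈M = subst (χ M p * sum (λ q → χ M q * χ L q) ≤_) (*-identityʳ (χ M p)) (*-monoʳ-≤ (χ M p)
      (sum≤1 (λ q → χ M q * χ L q) (λ q → *-mono-≤ (χ≤1 M q) (χ≤1 L q)) (common M∈ p∈M)))

-- Invariant partitions

module Classes {v : ℕ} (ℭ : Partition v) where

  cls : Fin v → Subset v
  cls p = proj₁ (class ℭ p)

  cls∈ : ∀ p → cls p ∈ᶠ classes ℭ
  cls∈ p = proj₁ (proj₁ (proj₂ (class ℭ p)))

  ∈cls : ∀ p → p ∈ cls p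
  ∈cls p = proj₂ (proj₁ (proj₂ (class ℭ p)))

  cls-unique : ∀ {p B} → B ∈ᶠ classes ℭ → p ∈ B → cls p ≡ B
  cls-unique {p} B∈ p∈B = proj₂ (proj₂ (class ℭ p)) (B∈ , p∈B)

  cls-cong : ∀ {p q} → q ∈ cls p → cls q ≡ cls p
  cls-cong {p} q∈ = cls-unique (cls∈ p) q∈

  same : Fin v → Fin v → ℕ
  same p q = χ (cls p) q

  same-refl : ∀ p → same p p ≡ 1
  same-refl p = χ-∈ (∈cls p)

  same-sym : ∀ p q → same p q ≡ same q p
  same-sym p q = χ-cong {B = cls p} {cls q} flip flip
    where
    flip : ∀ {p q} → q ∈ cls p → p ∈ cls q
    flip {p} {q} q∈ = subst (p ∈_) (sym (cls-cong q∈)) (∈cls p)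

  members-sum : ∀ q → sumᶠ (classes ℭ) (λ B → χ B q) ≡ 1
  members-sum q = trans
    (sumᶠ-point (classes ℭ) (λ B → χ B q) (cls∈ q)
      λ B∈ B≢ → χ-∉ λ q∈B → B≢ (sym (cls-unique B∈ q∈B)))
    (same-refl q)

  -- Split the sum over the classes: each contributes `c` times the constant value of `f` on it.
  class-sum-∣ : ∀ {c} (f : Fin v → ℕ) → (∀ p → ∣ cls p ∣ ≡ c) →
    (∀ p {q} → q ∈ cls p → f q ≡ f p) → c ∣ sum f
  class-sum-∣ {c} f sizes const = subst (c ∣_) (sym split)
    (sum-∣ (λ i → sum (λ q → χ (List.lookup (members (classes ℭ)) i) q * f q))
      λ i → divisible (∈-lookup i))
    where
    split : sum f ≡ sumᶠ (classes ℭ) (λ B → sum (λ q → χ B q * f q))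
    split = sym (begin
      sumᶠ (classes ℭ) (λ B → sum (λ q → χ B q * f q))
        ≡⟨ sumᶠ-sum (classes ℭ) (λ B q → χ B q * f q) ⟩
      sum (λ q → sumᶠ (classes ℭ) (λ B → χ B q * f q))
        ≡⟨ Σ.sum-cong-≗ (λ q → trans (sym (*-distribʳ-sumᶠ (classes ℭ) (f q) (λ B → χ B q)))
              (trans (cong (_* f q) (members-sum q)) (*-identityˡ (f q)))) ⟩
      sum f ∎)
      where open ≡-Reasoning
    divisible : ∀ {B} → B ∈ᶠ classes ℭ → c ∣ sum (λ q → χ B q * f q)
    divisible {B} B∈ with p , p∈B ← nonempty ℭ B∈ with refl ← cls-unique B∈ p∈B =
      subst (c ∣_) (sym (begin
        sum (λ q → χ B q * f q)  ≡⟨ Σ.sum-cong-≗ on-class ⟩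
        sum (λ q → χ B q * f p)  ≡⟨ Σ.*-distribʳ-sum {v} (f p) (χ B) ⟨
        sum (χ B) * f p          ≡⟨ cong (_* f p) (trans (sum-χ B) (sizes p)) ⟩
        c * f p                  ≡⟨ *-comm c (f p) ⟩
        f p * c                  ∎)) (n∣m*n (f p))
      where
      open ≡-Reasoning
      on-class : ∀ q → χ B q * f q ≡ χ B q * f p
      on-class q with q ∈? B
      ... | yes q∈B = cong (χ B q *_) (const p q∈B)
      ... | no  q∉B rewrite χ-∉ q∉B = refl

  module _ {ℓ} {G : Pred (Permutation′ v) ℓ} (invariant : Invariant G ℭ) where

    cls-image : ∀ {g} → G g → ∀ p → cls (g ⟨$⟩ʳ p) ≡ image g (cls p)
    cls-image {g} Gg p = cls-unique (invariant Gg (cls∈ p)) (∈-image g (∈cls p))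

    same-invariant : ∀ {g} → G g → ∀ p q → same (g ⟨$⟩ʳ p) (g ⟨$⟩ʳ q) ≡ same p q
    same-invariant {g} Gg p q =
      trans (cong (λ B → χ B (g ⟨$⟩ʳ q)) (cls-image Gg p)) (χ-image g (cls p) q)

-- Consequences of line-transitivity

module Transitive {ℓ} {v k r : ℕ} (𝒮 : LinearSpace v)
  (line-size : ConstantLineSize 𝒮 k)
  (degree : ∀ p → length (linesThrough 𝒮 p) ≡ r)
  (1<r : 1 < r) {L₀ : Subset v} (L₀∈ : L₀ ∈ᶠ lines 𝒮)
  (G : Pred (Permutation′ v) ℓ) (transitive : LineTransitive 𝒮 G) where

  open Counting 𝒮 line-size degree

  module _ (w : Fin v → ℕ) (invariant : ∀ {g} → G g → ∀ p → w (g ⟨$⟩ʳ p) ≡ w p) where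

    line-weight : ∀ {L} → L ∈ᶠ lines 𝒮 →
      sum (λ q → χ L q * w q) ≡ sum (λ q → χ L₀ q * w q)
    line-weight L∈ with g , Gg , refl ← transitive L₀∈ L∈ = sum-image g L₀ w (invariant {g} Gg)

  -- Comparing the pencil identity at p and q for the indicator f of { x ∣ w x ≡ w p }:
  -- f q ≡ 0 would force r ≡ 1.
  invariant⇒constant : (w : Fin v → ℕ) → (∀ {g} → G g → ∀ p → w (g ⟨$⟩ʳ p) ≡ w p) →
    ∀ p q → w p ≡ w q
  invariant⇒constant w invariant p q with w q ≟ w p
  ... | yes eq = sym eq
  ... | no  wq≢wp = contradiction r≡1 (>⇒≢ 1<r)
    where
    f : Fin v → ℕ
    f x = bit (does (w x ≟ w p))
    m = sum (λ x → χ L₀ x * f x)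
    f-lines : ∀ {L} → L ∈ᶠ lines 𝒮 → sum (λ x → χ L x * f x) ≡ m
    f-lines = line-weight f λ {g} Gg x → cong (λ y → bit (does (y ≟ w p))) (invariant {g} Gg x)
    fp≡1 : f p ≡ 1
    fp≡1 = bit-true (w p ≟ w p) refl
    fq≡0 : f q ≡ 0
    fq≡0 = bit-false (w q ≟ w p) wq≢wp
    at : ∀ x {y} → f x ≡ y → r * m + y ≡ sum f + r * y
    at x refl = pencil-constant x f f-lines
    r≡1 : r ≡ 1
    r≡1 = +-cancelˡ-≡ (sum f) r 1 (begin
      sum f + r         ≡⟨ cong (sum f +_) (*-identityʳ r) ⟨
      sum f + r * 1     ≡⟨ at p fp≡1 ⟨
      r * m + 1         ≡⟨ cong (_+ 1) (+-identityʳ (r * m)) ⟨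
      r * m + 0 + 1     ≡⟨ cong (_+ 1) (at q fq≡0) ⟩
      sum f + r * 0 + 1 ≡⟨ cong (λ z → sum f + z + 1) (*-zeroʳ r) ⟩
      sum f + 0 + 1     ≡⟨ cong (_+ 1) (+-identityʳ (sum f)) ⟩
      sum f + 1         ∎)
      where open ≡-Reasoning

  module _ (ℭ : Partition v) (invariant : Invariant G ℭ) where

    open Classes ℭ

    -- The size of the class of a point is a `G`-invariant weight; `invariant⇒constant` takes the
    -- place of point-transitivity.
    class-size-constant : ∀ p q → ∣ cls p ∣ ≡ ∣ cls q ∣
    class-size-constant = invariant⇒constant (λ p → ∣ cls p ∣) λ {g} Gg p →
      trans (cong ∣_∣ (cls-image (λ {h} → invariant {h}) {g} Gg p)) (∣image∣ g (cls p))

    -- Counts ordered pairs of points of `L` in a common class, the diagonal included; hence the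
    -- value `k + 2 * t` below.
    inner : Subset v → ℕ
    inner L = sum (λ p → χ L p * sum (λ q → χ L q * same p q))

    inner-constant : ∀ {L} → L ∈ᶠ lines 𝒮 → inner L ≡ inner L₀
    inner-constant L∈ with g , Gg , refl ← transitive L₀∈ L∈ =
      trans (Σ.sum-permute (λ p → χ (image g L₀) p * sum (λ q → χ (image g L₀) q * same p q)) g)
        (Σ.sum-cong-≗ λ p → cong₂ _*_ (χ-image g L₀ p)
          (trans (Σ.sum-permute (λ q → χ (image g L₀) q * same (g ⟨$⟩ʳ p) q) g)
            (Σ.sum-cong-≗ λ q → cong₂ _*_ (χ-image g L₀ q)
              (same-invariant (λ {h} → invariant {h}) {g} Gg p q))))

    -- t is the number of inner pairs of a line, the Delandtsheer–Doyen parameter x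
    inner-pairs : Fin v → ∀ {c} .{{_ : NonZero c}} → (∀ p → ∣ cls p ∣ ≡ c) →
      ∃[ t ] r * (2 * t) ≡ k * pred c
    inner-pairs p₀ {c} sizes = t , *-cancelˡ-≡ (r * (2 * t)) (k * pred c) v (begin
      -- Multiplying by `v`, nonzero because of `p₀`, lets `flags` trade `v r` for `b k`.
      v * (r * (2 * t))    ≡⟨ *-assoc v r (2 * t) ⟨
      v * r * (2 * t)      ≡⟨ cong (_* (2 * t)) flags ⟨
      b * k * (2 * t)      ≡⟨ exchange b k (2 * t) ⟩
      k * (b * (2 * t))    ≡⟨ cong (k *_) total ⟩
      k * (v * pred c)     ≡⟨ exchange′ k v (pred c) ⟩
      v * (k * pred c)     ∎)
      where
      open ≡-Reasoning
      instance
        v≢0 : NonZero v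
        v≢0 = Fin.nonZeroIndex p₀
      exchange : ∀ a b c → a * b * c ≡ b * (a * c)
      exchange = solve-∀
      exchange′ : ∀ a b c → a * (b * c) ≡ b * (a * c)
      exchange′ = solve-∀
      s : Fin v → Fin v → ℕ
      s p q = χ L₀ p * (χ L₀ q * same p q)
      s-sym : ∀ p q → s p q ≡ s q p
      s-sym p q = trans (exchange′ (χ L₀ p) (χ L₀ q) (same p q))
        (cong (λ e → χ L₀ q * (χ L₀ p * e)) (same-sym p q))
      s-diagonal : ∀ p → s p p ≡ χ L₀ p
      s-diagonal p = trans (cong (λ e → χ L₀ p * (χ L₀ p * e)) (same-refl p))
        (trans (cong (χ L₀ p *_) (*-identityʳ (χ L₀ p))) (χ-idem L₀ p))
      t : ℕ
      t = proj₁ (symmetric-sum s s-sym)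
      inner≡ : inner L₀ ≡ k + 2 * t
      inner≡ = begin
        inner L₀                       ≡⟨ Σ.sum-cong-≗ (λ p → Σ.*-distribˡ-sum {v} (χ L₀ p) _) ⟩
        sum (λ p → sum (s p))          ≡⟨ proj₂ (symmetric-sum s s-sym) ⟩
        sum (λ p → s p p) + 2 * t      ≡⟨ cong (_+ 2 * t) (trans (Σ.sum-cong-≗ s-diagonal) (line-sum L₀∈)) ⟩
        k + 2 * t                      ∎
      -- The sum over all `p` of the pencil identity for the indicator of the class of `p`.
      all-inner : b * (k + 2 * t) + v ≡ v * c + v * r
      all-inner = begin
        b * (k + 2 * t) + v
          ≡⟨ cong₂ _+_ (sumᶠ-constant (lines 𝒮) λ L∈ → trans (inner-constant L∈) inner≡)
                       (trans (Σ.sum-cong-≗ same-refl) (trans (sum-const v 1) (*-identityʳ v))) ⟨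
        sumᶠ (lines 𝒮) inner + sum (λ p → same p p)
          ≡⟨ cong (_+ sum (λ p → same p p))
               (sumᶠ-sum (lines 𝒮) (λ L p → χ L p * sum (λ q → χ L q * same p q))) ⟩
        sum (λ p → sumᶠ (lines 𝒮) (λ L → χ L p * sum (λ q → χ L q * same p q))) + sum (λ p → same p p)
          ≡⟨ Σ.∑-distrib-+ {v} _ _ ⟨
        sum (λ p → sumᶠ (lines 𝒮) (λ L → χ L p * sum (λ q → χ L q * same p q)) + same p p)
          ≡⟨ Σ.sum-cong-≗ (λ p → trans (pencil p (same p))
               (cong₂ _+_ (trans (sum-χ (cls p)) (sizes p))
                          (trans (cong (r *_) (same-refl p)) (*-identityʳ r)))) ⟩
        sum {v} (λ _ → c + r)
          ≡⟨ trans (sum-const v (c + r)) (*-distribˡ-+ v c r) ⟩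
        v * c + v * r ∎
      total : b * (2 * t) ≡ v * pred c
      total = +-cancelʳ-≡ (v * r + v) _ _ (begin
        b * (2 * t) + (v * r + v)       ≡⟨ cong (λ m → b * (2 * t) + (m + v)) flags ⟨
        b * (2 * t) + (b * k + v)       ≡⟨ regroup b (2 * t) k v ⟩
        b * (k + 2 * t) + v             ≡⟨ all-inner ⟩
        v * c + v * r                   ≡⟨ cong (λ c → v * c + v * r) (suc-pred c) ⟨
        v * suc (pred c) + v * r        ≡⟨ regroup′ v (pred c) r ⟩
        v * pred c + (v * r + v)        ∎)
        where
        regroup : ∀ b t k v → b * t + (b * k + v) ≡ b * (k + t) + v
        regroup = solve-∀
        regroup′ : ∀ v c r → v * suc c + v * r ≡ v * c + (v * r + v)
        regroup′ = solve-∀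

-- Refuting a strict refinement

two-members : ∀ {Bs : List (Subset v)} → Unique Bs → 1 < length Bs →
  ∃[ B ] ∃[ C ] B ∈ₗ Bs × C ∈ₗ Bs × B ≢ C
two-members {Bs = _ ∷ []} _ (s≤s ())
two-members {Bs = B ∷ C ∷ _} ((B≢C All.∷ _) ∷ _) _ = B , C , here refl , there (here refl) , B≢C

-- Serves minimality with `ℭ` as the coarser partition and maximality with `ℭ` as the finer one. The
-- proof collects the hypotheses of `chain-impossible`.
no-refinement : ∀ {ℓ} {v k r : ℕ} (𝒮 : LinearSpace v) →
  ConstantLineSize 𝒮 k → 2 < k → k < v →
  (∀ p → length (linesThrough 𝒮 p) ≡ r) →
  (G : Pred (Permutation′ v) ℓ) → LineTransitive 𝒮 G → gcd k r ≤ 8 →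
  (𝔇 ℭ : Partition v) → NonTrivial 𝔇 → NonTrivial ℭ →
  Invariant G 𝔇 → Invariant G ℭ → ¬ 𝔇 StrictlyRefines ℭ
no-refinement {v = v} {k} {r} 𝒮 line-size 2<k k<v degree G transitive gcd≤8
  𝔇 ℭ (_ , 1<∣𝔇∣) (1<#ℭ , _) inv𝔇 invℭ (refines , different) =
  chain-impossible {t = proj₁ inner𝔇} {proj₁ innerℭ} 2<k k≤r gcd≤8 1<c c<c′ c′<v c∣c′ c′∣v
    (proj₂ inner𝔇) (proj₂ innerℭ) (points {{>-nonZero 0<k}} p₀)
  where
  0<k : 0 < k
  0<k = <-trans z<s 2<k
  1<v : 1 < v
  1<v = <-trans (<-trans (s≤s z<s) 2<k) k<v
  p₀ : Fin v
  p₀ = fromℕ< (<-trans z<s 1<v)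
  other : ∃[ q ] q ∉ ⁅ p₀ ⁆
  other = ∣∣<⇒∃∉ (subst (_< v) (sym (∣⁅x⁆∣≡1 p₀)) 1<v)
  p₀≢q₀ : p₀ ≢ proj₁ other
  p₀≢q₀ = x∉⁅y⁆⇒x≢y (proj₂ other) ∘ sym
  L : Subset v
  L = proj₁ (join 𝒮 p₀≢q₀)
  L∈ : L ∈ᶠ lines 𝒮
  L∈ = proj₁ (proj₁ (proj₂ (join 𝒮 p₀≢q₀)))
  open Counting 𝒮 line-size degree
  k≤r : k ≤ r
  -- A point off `L` exists because `k < v`.
  k≤r = fisher L∈ (proj₂ (∣∣<⇒∃∉ (subst (_< v) (sym (line-size L∈)) k<v)))
  open Transitive 𝒮 line-size degree (<-≤-trans (<-trans (s≤s z<s) 2<k) k≤r) L∈ G transitive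
  module 𝔻 = Classes 𝔇
  module ℂ = Classes ℭ
  c c′ : ℕ
  c  = ∣ 𝔻.cls p₀ ∣
  c′ = ∣ ℂ.cls p₀ ∣
  sizes𝔇 : ∀ p → ∣ 𝔻.cls p ∣ ≡ c
  sizes𝔇 p = class-size-constant 𝔇 inv𝔇 p p₀
  sizesℭ : ∀ p → ∣ ℂ.cls p ∣ ≡ c′
  sizesℭ p = class-size-constant ℭ invℭ p p₀
  cls⊆ : ∀ p → 𝔻.cls p ⊆ₛ ℂ.cls p
  cls⊆ p with C , C∈ , ⊆C ← refines (𝔻.cls∈ p) =
    subst (𝔻.cls p ⊆ₛ_) (sym (ℂ.cls-unique C∈ (⊆C (𝔻.∈cls p)))) ⊆C
  1<c : 1 < c
  1<c = 1<∣𝔇∣ (𝔻.cls∈ p₀)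
  c<c′ : c < c′
  -- With equal sizes every class of `𝔇` would fill the class of `ℭ` around it, and the partitions
  -- would coincide.
  c<c′ = ≤∧≢⇒< (p⊆q⇒∣p∣≤∣q∣ (cls⊆ p₀)) λ c≡c′ → different (same-classes c≡c′)
    where
    same-classes : c ≡ c′ → 𝔇 SameAs ℭ
    same-classes c≡c′ {B} = mk⇔
      (λ B∈ → let p , p∈B = nonempty 𝔇 B∈ in
        subst (_∈ᶠ classes ℭ) (trans (sym (cls≡ p)) (𝔻.cls-unique B∈ p∈B)) (ℂ.cls∈ p))
      (λ B∈ → let p , p∈B = nonempty ℭ B∈ in
        subst (_∈ᶠ classes 𝔇) (trans (cls≡ p) (ℂ.cls-unique B∈ p∈B)) (𝔻.cls∈ p))
      where
      cls≡ : ∀ p → 𝔻.cls p ≡ ℂ.cls p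
      cls≡ p = ⊆∧∣∣≥⇒≡ (cls⊆ p)
        (≤-reflexive (trans (sizesℭ p) (trans (sym c≡c′) (sym (sizes𝔇 p)))))
  c′<v : c′ < v
  -- If `c′ = v`, every class is the whole point set, against the existence of two distinct classes.
  c′<v = ≤∧≢⇒< (∣p∣≤n (ℂ.cls p₀)) λ c′≡v →
    let B , C , B∈ , C∈ , B≢C = two-members (unique (classes ℭ)) 1<#ℭ in
    B≢C (trans (full c′≡v B∈) (sym (full c′≡v C∈)))
    where
    full : c′ ≡ v → ∀ {B} → B ∈ᶠ classes ℭ → B ≡ ⊤
    full c′≡v B∈ with p , p∈B ← nonempty ℭ B∈ =
      trans (sym (ℂ.cls-unique B∈ p∈B)) (∣p∣≡n⇒p≡⊤ (trans (sizesℭ p) c′≡v))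
  c∣c′ : c ∣ c′
  -- The indicator of a class of `ℭ` is constant on each class of `𝔇` and sums to `c′`.
  c∣c′ = subst (c ∣_) (sum-χ (ℂ.cls p₀)) (𝔻.class-sum-∣ (ℂ.same p₀) sizes𝔇 λ p {q} q∈ → begin
    ℂ.same p₀ q  ≡⟨ ℂ.same-sym p₀ q ⟩
    ℂ.same q p₀  ≡⟨ cong (λ B → χ B p₀) (ℂ.cls-cong (cls⊆ p q∈)) ⟩
    ℂ.same p p₀  ≡⟨ ℂ.same-sym p p₀ ⟩
    ℂ.same p₀ p  ∎)
    where open ≡-Reasoning
  c′∣v : c′ ∣ v
  c′∣v = subst (c′ ∣_) (trans (sum-const v 1) (*-identityʳ v))
    (ℂ.class-sum-∣ (λ _ → 1) sizesℭ λ _ _ → refl)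
  inner𝔇 : ∃[ t ] r * (2 * t) ≡ k * pred c
  inner𝔇 = inner-pairs 𝔇 inv𝔇 p₀ {{>-nonZero (<-trans z<s 1<c)}} sizes𝔇
  innerℭ : ∃[ t ] r * (2 * t) ≡ k * pred c′
  innerℭ = inner-pairs ℭ invℭ p₀ {{>-nonZero (<-trans z<s (<-trans 1<c c<c′))}} sizesℭ

theorem4p11 : ∀ {ℓ : Level} (v k r : ℕ) (𝒮 : LinearSpace v) →
    ConstantLineSize 𝒮 k → 2 < k → k < v →
    (∀ p → length (linesThrough 𝒮 p) ≡ r) →
    (G : Pred (Permutation′ v) ℓ) → IsSubgroup G → G ⊆ Aut 𝒮 →
    LineTransitive 𝒮 G →
    (ℭ : Partition v) → NonTrivial ℭ → Invariant G ℭ →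
    gcd k r ≤ 8 →
    TwoStepImprimitive G ℭ
theorem4p11 v k r 𝒮 line-size 2<k k<v degree G _ _ transitive ℭ nontrivial invariant gcd≤8 =
  (λ (𝔇 , nontrivial′ , invariant′ , 𝔇<ℭ) →
    refute 𝔇 ℭ nontrivial′ nontrivial invariant′ invariant 𝔇<ℭ) ,
  (λ (𝔇 , nontrivial′ , invariant′ , ℭ<𝔇) →
    refute ℭ 𝔇 nontrivial nontrivial′ invariant invariant′ ℭ<𝔇)
  where
  refute = no-refinement 𝒮 line-size 2<k k<v degree G transitive gcd≤8
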